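{- Let $G=(V,E)$ be a finite, simple, connected AT-free graph. For every admissible vertex $s$ of $G$ there is a linear vertex ordering $\tau$ of $V$ beginning in $s$ that is both an AT-free order and a monotone dominating pair order of $G$.
   Context: An asteroidal triple of $G$ is an independent set of three vertices such that for any two of them there is a path between them containing no neighbour of the third; $G$ is AT-free if it has none. A path $P$ avoids a vertex $v$ if $v$ has no neighbour on $P$. The domination betweenness $\mathcal{B}_D(G)$ is the set of triples $(x,y,z)$ of distinct vertices such that there is a chordless $x$-$y$-path avoiding $z$ and a chordless $y$-$z$-path avoiding $x$. A vertex $y$ is admissible if there are no $x,z$ with $(x,y,z)\in\mathcal{B}_D(G)$. An AT-free order is an ordering $\tau$ of $V$ such that for every $(x,y,z)\in\mathcal{B}_D(G)$ we have $y\prec_\tau x$ or $y\prec_\tau z$. Two vertices $a,b$ form a dominating pair of a graph $H$ if the vertex set of every $a$-$b$-path in $H$ is a dominating set of $H$. An ordering $\tau=(v_1,\ldots,v_n)$ is a monotone dominating pair order if for every $i\in\{1,\ldots,n\}$ the vertices $v_1$ and $v_i$ form a dominating pair of the induced subgraph $G[\{v_1,\ldots,v_i\}]$. -}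

module Defs where

open import Data.Nat using (ℕ; _≤_; _<_)
open import Data.Bool using (Bool; true)
open import Data.Fin using (Fin; toℕ)
open import Data.List using (List; head; last; length; lookup)
open import Data.Maybe using (just)
open import Data.List.Relation.Unary.All using (All)
open import Data.List.Relation.Unary.Any using (Any)
open import Data.List.Relation.Unary.Linked using (Linked)
open import Data.List.Relation.Unary.Unique.Propositional using (Unique)
open import Data.Fin.Permutation using (Permutation′; _⟨$⟩ˡ_)
open import Data.Product using (Σ; _×_; ∃)
open import Data.Sum using (_⊎_)
open import Relation.Nullary using (¬_)
open import Relation.Binary.PropositionalEquality using (_≡_; _≢_)

record Graph (n : ℕ) : Set where
  field
    adj   : Fin n → Fin n → Bool
    sym   : ∀ u v → adj u v ≡ adj v u
    irrefl : ∀ v → adj v v ≢ true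

module _ {n : ℕ} (G : Graph n) where
  open Graph G

  V : Set
  V = Fin n

  Adj : V → V → Set
  Adj u v = adj u v ≡ true

  IsPath : V → V → List V → Set
  IsPath x y p = (head p ≡ just x) × (last p ≡ just y) × Unique p × Linked Adj p

  Chordless : List V → Set
  Chordless p = ∀ (i j : Fin (length p)) → ℕ.suc (toℕ i) < toℕ j →
                ¬ Adj (lookup p i) (lookup p j)

  IsChordlessPath : V → V → List V → Set
  IsChordlessPath x y p = IsPath x y p × Chordless p

  Avoids : List V → V → Set
  Avoids p v = All (λ u → ¬ Adj v u) p

  Connected : Set
  Connected = ∀ u v → ∃ λ p → IsPath u v p

  PathAvoiding : V → V → V → Set
  PathAvoiding x y z = ∃ λ p → IsPath x y p × Avoids p z

  AsteroidalTriple : V → V → V → Set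
  AsteroidalTriple x y z =
    (x ≢ y) × (y ≢ z) × (x ≢ z) ×
    ¬ Adj x y × ¬ Adj y z × ¬ Adj x z ×
    PathAvoiding x y z × PathAvoiding y z x × PathAvoiding x z y

  ATFree : Set
  ATFree = ∀ x y z → ¬ AsteroidalTriple x y z

  BD : V → V → V → Set
  BD x y z =
    (x ≢ y) × (y ≢ z) × (x ≢ z) ×
    (∃ λ p → IsChordlessPath x y p × Avoids p z) ×
    (∃ λ q → IsChordlessPath y z q × Avoids q x)

  Admissible : V → Set
  Admissible y = ∀ x z → ¬ BD x y z

  -- Orderings: τ ⟨$⟩ʳ i is the (i+1)-th vertex v_{i+1};
  -- the position of a vertex v is  pos τ v = τ ⟨$⟩ˡ v.
  pos : Permutation′ n → V → Fin n
  pos τ v = τ ⟨$⟩ˡ v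

  _≺[_]_ : V → Permutation′ n → V → Set
  u ≺[ τ ] v = toℕ (pos τ u) < toℕ (pos τ v)

  BeginsIn : Permutation′ n → V → Set
  BeginsIn τ s = toℕ (pos τ s) ≡ 0

  ATFreeOrder : Permutation′ n → Set
  ATFreeOrder τ = ∀ x y z → BD x y z → (y ≺[ τ ] x) ⊎ (y ≺[ τ ] z)

  DominatingPairIn : (V → Set) → V → V → Set
  DominatingPairIn S a b =
    ∀ p → IsPath a b p → All S p →
    ∀ w → S w → Any (λ u → (u ≡ w) ⊎ Adj u w) p

  -- prefix {v_1,…,v_i} corresponds to vertices at position ≤ position of v_i
  MonotoneDomPairOrder : Permutation′ n → Set
  MonotoneDomPairOrder τ =
    ∀ (s : V) → BeginsIn τ s →
    ∀ (v : V) → DominatingPairIn (λ w → toℕ (pos τ w) ≤ toℕ (pos τ v)) s v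

{-# OPTIONS --safe #-}

-- Fix s and let D(v) be the component of s in G − N[v] (empty if v ∈ N(s)).
-- If y is between x and z, AT-freeness forbids D(y) from meeting both N[x] and
-- N[z], so D(y) ⊆ D(x) or D(y) ⊆ D(z).  Hence if |D(y)| is maximal in a set S ∖ {s}
-- and x, z ∈ S, then x, z ≠ s and |D(x)| = |D(y)| = |D(z)|.  Choosing a new s among
-- the maximisers and recursing, one finds v ∈ S ∖ {s} with |D(v)| maximal that is not
-- between two vertices of S.  Removing such vertices one by one yields the order,
-- read backwards: it is AT-free by construction, and if s is admissible then
-- v ∈ D(w) implies D(v) ⊊ D(w), so no s-v-path avoids a vertex w preceding v.

module Submission where

open import Defs
open import Data.Product using (_×_; _,_; ∃; proj₁; proj₂)
open import Data.Bool using (true)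
import Data.Bool.Properties as Bool
open import Data.Fin using (Fin; zero; suc; toℕ; opposite)
open import Data.Fin.Permutation using (Permutation; Permutation′; permutation; _⟨$⟩ˡ_; _⟨$⟩ʳ_; inverseʳ; ↔⇒≡; reverse; _∘ₚ_)
open import Data.Fin.Properties using (_≟_; any?; injective⇒≤; toℕ<n; toℕ-injective; opposite-prop)
open import Data.Fin.Subset using (Subset; _⊆_; ∣_∣) renaming (_∈_ to _∈ₛ_)
open import Data.Fin.Subset.Properties using (p⊆q⇒∣p∣≤∣q∣; p⊂q⇒∣p∣<∣q∣)
open import Data.List using (List; []; _∷_; length; lookup; last; filter; allFin)
open import Data.Nat.Properties using (≤-refl; ≤-trans; ≤-pred; ≤-totalOrder; <⇒≱; ≮⇒≥; ∸-monoʳ-<; n∸n≡0; n≤1+n)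
open import Data.List.Extrema ≤-totalOrder using (argmax; argmax-sel; f[xs]≤f[argmax])
open import Data.List.Membership.Propositional using (_∈_; _∉_; lose; find)
open import Data.List.Membership.Propositional.Properties using (∈-lookup; ∈-filter⁺; ∈-filter⁻; ∈-allFin)
open import Data.List.Properties using (length-filter; filter-notAll)
open import Data.List.Relation.Unary.All as All using (All; []; _∷_)
open import Data.List.Relation.Unary.All.Properties using (¬Any⇒All¬)
open import Data.List.Relation.Unary.AllPairs using ([]; _∷_)
open import Data.List.Relation.Unary.Any as Any using (Any; here; there)
open import Data.List.Relation.Unary.Any.Properties using (lookup-index)
open import Data.List.Relation.Unary.Linked using ([-]; _∷_)
open import Data.List.Relation.Unary.Unique.Propositional using (Unique)
open import Data.Maybe using (just)
open import Data.Nat using (ℕ; zero; suc; _∸_; _≤_; _<_; z≤n; s≤s; _≤?_)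
open import Data.Sum using (_⊎_; inj₁; inj₂)
open import Data.Vec using (tabulate)
open import Data.Vec.Properties using (lookup∘tabulate; []=⇒lookup; lookup⇒[]=)
open import Function using (_∘_)
open import Relation.Binary.PropositionalEquality using (_≡_; _≢_; refl; sym; trans; cong; subst; subst₂; ≢-sym)
open import Relation.Nullary using (¬_; Dec; yes; no; contradiction; ¬?; _×-dec_; _⊎-dec_)
open import Relation.Nullary.Decidable using (map′; dec-true; decidable-stable)
open import Relation.Unary using (Decidable)

-- Lists, permutations and decidable subsets of `Fin n`.

lookup-injective : ∀ {A : Set} {xs : List A} → Unique xs →
                   ∀ {i j} → lookup xs i ≡ lookup xs j → i ≡ j
lookup-injective (_ ∷ _)  {zero}  {zero}  _  = refl
lookup-injective (x∉ ∷ _) {zero}  {suc j} eq = contradiction eq (All.lookup x∉ (∈-lookup j))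
lookup-injective (x∉ ∷ _) {suc i} {zero}  eq = contradiction (sym eq) (All.lookup x∉ (∈-lookup i))
lookup-injective (_ ∷ u)  {suc i} {suc j} eq = cong suc (lookup-injective u eq)

last-∈ : ∀ {A : Set} {x : A} xs → last xs ≡ just x → x ∈ xs
last-∈ (_ ∷ [])     refl = here refl
last-∈ (_ ∷ y ∷ xs) eq   = there (last-∈ (y ∷ xs) eq)

opposite-anti-< : ∀ {n} {i j : Fin n} → toℕ i < toℕ j → toℕ (opposite j) < toℕ (opposite i)
opposite-anti-< {i = i} {j} i<j =
  subst₂ _<_ (sym (opposite-prop j)) (sym (opposite-prop i)) (∸-monoʳ-< (s≤s i<j) (toℕ<n j))

-- The equality `m ≡ n` can be matched only while both are variables, which fails for `length L`
-- with `L` a list over `Fin n`.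
toEndo : ∀ {m n} (π : Permutation m n) →
         ∃ λ (τ : Permutation′ n) → ∀ v → toℕ (τ ⟨$⟩ˡ v) ≡ toℕ (π ⟨$⟩ˡ v)
toEndo π with refl ← ↔⇒≡ π = π , λ _ → refl

module _ {n : ℕ} {P : Fin n → Set} (P? : Decidable P) where

  toSubset : Subset n
  toSubset = tabulate (Dec.does ∘ P?)

  ∈-toSubset⁺ : ∀ {u} → P u → u ∈ₛ toSubset
  ∈-toSubset⁺ {u} p = lookup⇒[]= u _ (trans (lookup∘tabulate _ u) (dec-true (P? u) p))

  ∈-toSubset⁻ : ∀ {u} → u ∈ₛ toSubset → P u
  ∈-toSubset⁻ {u} u∈ with P? u | trans (sym (lookup∘tabulate (Dec.does ∘ P?) u)) ([]=⇒lookup u∈)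
  ... | yes p | _ = p
  ... | no _  | ()

module _ {n : ℕ} (G : Graph n) where

  private
    _~_ : V G → V G → Set
    _~_ = Adj G

    variable
      s u v w x y z : V G
      p q : List (V G)

  ~-sym : u ~ v → v ~ u
  ~-sym {u} {v} uv = trans (Graph.sym G v u) uv

  _~?_ : ∀ u v → Dec (u ~ v)
  u ~? v = Graph.adj G u v Bool.≟ true

  -- Chordless paths and walks

  -- Chordless paths grown from the front: a new first vertex may be adjacent to its successor only.
  data Induced : V G → V G → List (V G) → Set where
    single : Induced x x (x ∷ [])
    extend : u ~ x → u ∉ x ∷ p → All (λ w → ¬ u ~ w) p →
             Induced x y (x ∷ p) → Induced u y (u ∷ x ∷ p)

  induced⇒isPath : Induced x y p → IsPath G x y p
  induced⇒isPath single = refl , refl , [] ∷ [] , [-]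
  induced⇒isPath (extend ux u∉ _ i) with induced⇒isPath i
  ... | refl , l , uq , lk = refl , l , ¬Any⇒All¬ _ u∉ ∷ uq , ux ∷ lk

  induced⇒chordless : Induced x y p → Chordless G p
  induced⇒chordless single                zero    zero          ()
  induced⇒chordless (extend _ _ _ _)      zero    (suc zero)    (s≤s ())
  induced⇒chordless (extend _ _ ¬u~ _)    zero    (suc (suc j)) _       = All.lookup ¬u~ (∈-lookup j)
  induced⇒chordless (extend _ _ _ i)      (suc k) (suc j)       (s≤s l) = induced⇒chordless i k j l

  induced-suffix : ∀ {Q : V G → Set} → Induced x y p → All Q p → u ∈ p →
                   ∃ λ q → Induced u y q × All Q q
  induced-suffix i@single            qs (here refl) = _ , i , qs
  induced-suffix i@(extend _ _ _ _)  qs (here refl) = _ , i , qs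
  induced-suffix (extend _ _ _ i) (_ ∷ qs) (there u∈) = induced-suffix i qs u∈

  -- Entering the path at its last vertex adjacent to u creates no chord.
  induced-prepend : ∀ {Q : V G → Set} → Induced x y p → All Q p → Q u → u ∉ p → Any (u ~_) p →
                    ∃ λ q → Induced u y q × All Q q
  induced-prepend single qs qu u∉ (here ux) = _ , extend ux u∉ [] single , qu ∷ qs
  induced-prepend {u = u} i@(extend {x = x′} {p = p′} _ _ _ i′) qs@(_ ∷ qs′) qu u∉ a
    with Any.any? (u ~?_) (x′ ∷ p′) | a
  ... | yes a′ | _        = induced-prepend i′ qs′ qu (u∉ ∘ there) a′
  ... | no ¬a′ | there a′ = contradiction a′ ¬a′
  ... | no ¬a′ | here ux  = _ , extend ux u∉ (¬Any⇒All¬ _ ¬a′) i , qu ∷ qs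

  -- Vertices may repeat, so walks can be concatenated freely; `Q` holds at every vertex, both ends
  -- included.
  data Walk (Q : V G → Set) : V G → V G → Set where
    stop : Q x → Walk Q x x
    step : Q x → x ~ y → Walk Q y z → Walk Q x z

  module _ {Q : V G → Set} where

    walk-head : Walk Q x y → Q x
    walk-head (stop q)     = q
    walk-head (step q _ _) = q

    walk-++ : Walk Q x y → Walk Q y z → Walk Q x z
    walk-++ (stop _)     W′ = W′
    walk-++ (step q e W) W′ = step q e (walk-++ W W′)

    walk-sym : Walk Q x y → Walk Q y x
    walk-sym (stop q)     = stop q
    walk-sym (step q e W) = walk-++ (walk-sym W) (step (walk-head W) (~-sym e) (stop q))

    walk-snoc : Walk Q x y → y ~ z → Q z → Walk Q x z
    walk-snoc W e q = walk-++ W (step (walk-head (walk-sym W)) e (stop q))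

    isPath⇒walk : ∀ p → IsPath G x y p → All Q p → Walk Q x y
    isPath⇒walk (x ∷ [])    (refl , refl , _ , _) (q ∷ _) = stop q
    isPath⇒walk (x ∷ y ∷ p) (refl , l , _ ∷ uq , e ∷ lk) (q ∷ qs) =
      step q e (isPath⇒walk (y ∷ p) (refl , l , uq , lk) qs)

    -- If the new first vertex already lies on the chordless path, the path is cut back to it;
    -- otherwise it is prepended with a shortcut.
    walk⇒induced : Walk Q x y → ∃ λ p → Induced x y p × All Q p
    walk⇒induced (stop q) = _ , single , q ∷ []
    walk⇒induced {x} (step q e W) with walk⇒induced W
    ... | p , i , qs with Any.any? (x ≟_) p
    ...   | yes x∈ = induced-suffix i qs x∈
    ...   | no  x∉ = induced-prepend i qs q x∉ (start i)
      where
      start : Induced _ _ p → Any (x ~_) p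
      start single           = here e
      start (extend _ _ _ _) = here e

    -- Walks with at most `k` edges, a form that can be decided by recursion on `k`.
    WalkWithin : ℕ → V G → V G → Set
    WalkWithin zero    x y = Q x × x ≡ y
    WalkWithin (suc k) x y = Q x × (x ≡ y ⊎ ∃ λ w → x ~ w × WalkWithin k w y)

    walkWithin⇒walk : ∀ k → WalkWithin k x y → Walk Q x y
    walkWithin⇒walk zero    (q , refl)               = stop q
    walkWithin⇒walk (suc k) (q , inj₁ refl)          = stop q
    walkWithin⇒walk (suc k) (q , inj₂ (_ , e , W))   = step q e (walkWithin⇒walk k W)

    induced⇒walkWithin : ∀ k → Induced x y p → All Q p → length p ≤ suc k → WalkWithin k x y
    induced⇒walkWithin zero    single            (q ∷ _)  _       = q , refl
    induced⇒walkWithin (suc k) single            (q ∷ _)  _       = q , inj₁ refl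
    induced⇒walkWithin zero    (extend _ _ _ _)  _        (s≤s ())
    induced⇒walkWithin (suc k) (extend e _ _ i)  (q ∷ qs) (s≤s l) =
      q , inj₂ (_ , e , induced⇒walkWithin k i qs l)

    -- A chordless path repeats no vertex, so it has at most `n` of them.
    walk⇒walkWithin : Walk Q x y → WalkWithin n x y
    walk⇒walkWithin W with walk⇒induced W
    ... | p , i , qs = induced⇒walkWithin n i qs (≤-trans length≤n (n≤1+n n))
      where
      length≤n : length p ≤ n
      length≤n = injective⇒≤ (lookup-injective (proj₁ (proj₂ (proj₂ (induced⇒isPath i)))))

    module _ (Q? : Decidable Q) where

      walkWithin? : ∀ k x y → Dec (WalkWithin k x y)
      walkWithin? zero    x y = Q? x ×-dec (x ≟ y)
      walkWithin? (suc k) x y =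
        Q? x ×-dec ((x ≟ y) ⊎-dec any? (λ w → (x ~? w) ×-dec walkWithin? k w y))

      walk? : ∀ x y → Dec (Walk Q x y)
      walk? x y = map′ (walkWithin⇒walk n) walk⇒walkWithin (walkWithin? n x y)

  -- Betweenness in terms of walks

  WalkAvoiding : V G → V G → V G → Set
  WalkAvoiding z = Walk (λ u → ¬ z ~ u)

  walkAvoiding? : ∀ z x y → Dec (WalkAvoiding z x y)
  walkAvoiding? z = walk? (λ u → ¬? (z ~? u))

  -- Only the neighbours of `x` are forbidden, not `x` itself; but leaving `x` means entering a
  -- neighbour.
  walkAvoiding-start : WalkAvoiding x x y → x ≡ y
  walkAvoiding-start (stop _)     = refl
  walkAvoiding-start (step _ e W) = contradiction e (walk-head W)

  -- At the first neighbour of `x` on the walk, step over to `x`; this still avoids `y`. If there is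
  -- no such neighbour, the walk itself avoids `x`.
  walkAvoiding-split : ¬ y ~ x → WalkAvoiding y s u → WalkAvoiding x s u ⊎ WalkAvoiding y s x
  walkAvoiding-split {x = x} {s} ¬yx (stop q) with x ~? s
  ... | yes xs = inj₂ (step q (~-sym xs) (stop ¬yx))
  ... | no ¬xs = inj₁ (stop ¬xs)
  walkAvoiding-split {x = x} {s} ¬yx (step q e W) with x ~? s | walkAvoiding-split ¬yx W
  ... | yes xs | _       = inj₂ (step q (~-sym xs) (stop ¬yx))
  ... | no ¬xs | inj₁ W′ = inj₁ (step ¬xs e W′)
  ... | no _   | inj₂ W′ = inj₂ (step q e W′)

  -- `BD` with walks in place of chordless paths; equivalent, since an avoiding walk can be
  -- shortened to an avoiding chordless path.
  record Between (x y z : V G) : Set where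
    constructor between
    field
      x≢y : x ≢ y
      y≢z : y ≢ z
      x≢z : x ≢ z
      xy  : WalkAvoiding z x y
      yz  : WalkAvoiding x y z

    y≁x : ¬ y ~ x
    y≁x = walk-head yz ∘ ~-sym

    y≁z : ¬ y ~ z
    y≁z = walk-head (walk-sym xy) ∘ ~-sym

  between-sym : Between x y z → Between z y x
  between-sym (between a b c p q) = between (≢-sym b) (≢-sym a) (≢-sym c) (walk-sym q) (walk-sym p)

  BD⇒between : BD G x y z → Between x y z
  BD⇒between (a , b , c , (p , (ip , _) , ap) , (q , (iq , _) , aq)) =
    between a b c (isPath⇒walk p ip ap) (isPath⇒walk q iq aq)

  walk⇒chordlessPath : WalkAvoiding z x y → ∃ λ p → IsChordlessPath G x y p × Avoids G p z
  walk⇒chordlessPath W with walk⇒induced W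
  ... | p , i , a = p , (induced⇒isPath i , induced⇒chordless i) , a

  walk⇒pathAvoiding : WalkAvoiding z x y → PathAvoiding G x y z
  walk⇒pathAvoiding W with walk⇒chordlessPath W
  ... | p , (ip , _) , a = p , ip , a

  between⇒BD : Between x y z → BD G x y z
  between⇒BD (between a b c p q) = a , b , c , walk⇒chordlessPath p , walk⇒chordlessPath q

  -- The sets D(v)

  abstract

    -- D(v) as a finite subset, to give it a cardinality; elsewhere membership of `u` in D(v) is
    -- written `WalkAvoiding v s u`.
    component : (s v : V G) → Subset n
    component s v = toSubset (walkAvoiding? v s)

    depth : V G → V G → ℕ
    depth s v = ∣ component s v ∣

    component-⊆ : (∀ {u} → WalkAvoiding x s u → WalkAvoiding y s u) → component s x ⊆ component s y
    component-⊆ {x} {s} {y} sub =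
      ∈-toSubset⁺ (walkAvoiding? y s) ∘ sub ∘ ∈-toSubset⁻ (walkAvoiding? x s)

    depth-mono-≤ : (∀ {u} → WalkAvoiding x s u → WalkAvoiding y s u) → depth s x ≤ depth s y
    depth-mono-≤ {x} {s} {y} sub = p⊆q⇒∣p∣≤∣q∣ {p = component s x} {component s y} (component-⊆ sub)

    depth-mono-< : (∀ {u} → WalkAvoiding x s u → WalkAvoiding y s u) →
                   WalkAvoiding y s w → ¬ WalkAvoiding x s w → depth s x < depth s y
    depth-mono-< {x} {s} {y} sub w∈ w∉ =
      p⊂q⇒∣p∣<∣q∣ {p = component s x} {component s y}
        (component-⊆ sub , _ , ∈-toSubset⁺ (walkAvoiding? y s) w∈ , w∉ ∘ ∈-toSubset⁻ (walkAvoiding? x s))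

  -- A walk inside D(y) that met a neighbour of `x` could be extended to `x`, putting `x` into D(y).
  ⊆-of-∉ : ¬ y ~ x → ¬ WalkAvoiding y s x → ∀ {u} → WalkAvoiding y s u → WalkAvoiding x s u
  ⊆-of-∉ y≁x ¬W W with walkAvoiding-split y≁x W
  ... | inj₁ W′ = W′
  ... | inj₂ W′ = contradiction W′ ¬W

  ∉-own-component : v ≢ s → ¬ WalkAvoiding v s v
  ∉-own-component v≢s W = v≢s (walkAvoiding-start (walk-sym W))

  -- Says that both ends survive among the maximisers when `y` has maximal depth.
  record Level (s x y z : V G) : Set where
    constructor level
    field
      x≢s : x ≢ s
      z≢s : z ≢ s
      y≤x : depth s y ≤ depth s x
      y≤z : depth s y ≤ depth s z

  -- As `z` is outside D(y), D(y) ⊆ D(z). If `y` were in D(z), the inclusion would be strict,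
  -- against maximality. The walk from `x` to `y` avoiding `z` then keeps `x` out of D(z), hence out
  -- of D(y), and D(y) ⊆ D(x) follows.
  between-level-of-∉ : Between x y z → y ≢ s → ¬ WalkAvoiding y s z →
                       (z ≢ s → depth s z ≤ depth s y) → Level s x y z
  between-level-of-∉ {x} {y} {z} {s} b y≢s z∉Dy max =
    level x≢s z≢s (depth-mono-≤ (⊆-of-∉ y≁x x∉Dy)) (depth-mono-≤ Dy⊆Dz)
    where
    open Between b using (xy; y≁x; y≁z)

    z≢s : z ≢ s
    z≢s refl = z∉Dy (stop y≁z)

    Dy⊆Dz : ∀ {u} → WalkAvoiding y s u → WalkAvoiding z s u
    Dy⊆Dz = ⊆-of-∉ y≁z z∉Dy

    y∉Dz : ¬ WalkAvoiding z s y
    y∉Dz W = <⇒≱ (depth-mono-< Dy⊆Dz W (∉-own-component y≢s)) (max z≢s)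

    x≢s : x ≢ s
    x≢s refl = y∉Dz xy

    x∉Dy : ¬ WalkAvoiding y s x
    x∉Dy W = y∉Dz (walk-++ (Dy⊆Dz W) xy)

  -- Existence of a deepest vertex that is between no two vertices of a set.

  Extreme : List (V G) → V G → Set
  Extreme S v = ∀ {x z} → x ∈ S → z ∈ S → ¬ Between x v z

  module _ (atFree : ATFree G) where

    -- `W` would be the third walk of an asteroidal triple; independence is read off the ends of the
    -- walks.
    between-no-AT : Between x y z → ¬ WalkAvoiding y x z
    between-no-AT b@(between a b′ c p q) W =
      atFree _ _ _ (a , b′ , c , y≁x ∘ ~-sym , y≁z , walk-head (walk-sym q) ,
                    walk⇒pathAvoiding p , walk⇒pathAvoiding q , walk⇒pathAvoiding W)
      where open Between b using (y≁x; y≁z)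

    -- If `x` and `z` both lay in D(y), joining their walks at `s` would give a walk from `x` to `z`
    -- avoiding `y`. The other two cases are mirror images.
    between-level : Between x y z → y ≢ s → (x ≢ s → depth s x ≤ depth s y) →
                    (z ≢ s → depth s z ≤ depth s y) → Level s x y z
    between-level {x} {y} {z} {s} b y≢s maxx maxz with walkAvoiding? y s z | walkAvoiding? y s x
    ... | no z∉  | _      = between-level-of-∉ b y≢s z∉ maxz
    ... | yes _  | no x∉ with between-level-of-∉ (between-sym b) y≢s x∉ maxx
    ...   | level z≢s x≢s y≤z y≤x = level x≢s z≢s y≤x y≤z
    between-level b _ _ _ | yes z∈ | yes x∈ =
      contradiction (walk-++ (walk-sym x∈) z∈) (between-no-AT b)

    exists-extreme : ∀ k S → length S ≤ k → s ∈ S → Any (_≢ s) S →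
                     ∃ λ v → v ∈ S × v ≢ s × Extreme S v ×
                             (∀ {w} → w ∈ S → w ≢ s → depth s w ≤ depth s v)
    exists-extreme zero [] z≤n ()
    exists-extreme {s} (suc k) S |S|≤ s∈S ∃≢s = result
      where
      ≢s? : Decidable (_≢ s)
      ≢s? w = ¬? (w ≟ s)

      T : List (V G)
      T = filter ≢s? S

      t : V G
      t = proj₁ (find ∃≢s)

      t∈T : t ∈ T
      t∈T = ∈-filter⁺ ≢s? (proj₁ (proj₂ (find ∃≢s))) (proj₂ (proj₂ (find ∃≢s)))

      m : V G
      m = argmax (depth s) t T

      m∈T : m ∈ T
      m∈T with argmax-sel (depth s) t T
      ... | inj₁ eq = subst (_∈ T) (sym eq) t∈T
      ... | inj₂ m∈ = m∈

      m-max : ∀ {w} → w ∈ S → w ≢ s → depth s w ≤ depth s m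
      m-max w∈ w≢s = All.lookup (f[xs]≤f[argmax] t T) (∈-filter⁺ ≢s? w∈ w≢s)

      deep? : Decidable (λ w → depth s m ≤ depth s w)
      deep? w = depth s m ≤? depth s w

      M : List (V G)
      M = filter deep? T

      m∈M : m ∈ M
      m∈M = ∈-filter⁺ deep? m∈T ≤-refl

      |M|≤k : length M ≤ k
      -- Filtering out `s` removes at least one entry.
      |M|≤k = ≤-pred (≤-trans (s≤s (length-filter deep? T))
                     (≤-trans (filter-notAll ≢s? S (lose s∈S (λ s≢s → s≢s refl))) |S|≤))

      ∃-extreme-M : ∃ λ v → v ∈ M × Extreme M v
      ∃-extreme-M with Any.any? (λ w → ¬? (w ≟ m)) M
      -- With `m` as root, depths are measured from `m`, so only the extremality of the result is
      -- kept.
      ... | yes ∃≢m with exists-extreme k M |M|≤k m∈M ∃≢m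
      ...   | v , v∈ , _ , ext , _ = v , v∈ , ext
      ∃-extreme-M | no ∄≢m = m , m∈M , λ x∈ _ b → ∄≢m (lose x∈ (Between.x≢y b))

      result : ∃ λ v → v ∈ S × v ≢ s × Extreme S v ×
                       (∀ {w} → w ∈ S → w ≢ s → depth s w ≤ depth s v)
      result with ∃-extreme-M
      ... | v , v∈M , ext with ∈-filter⁻ deep? {xs = T} v∈M
      ...   | v∈T , m≤v with ∈-filter⁻ ≢s? {xs = S} v∈T
      ...     | v∈S , v≢s = v , v∈S , v≢s , ext′ , v-max
        where
        v-max : ∀ {w} → w ∈ S → w ≢ s → depth s w ≤ depth s v
        v-max w∈ w≢s = ≤-trans (m-max w∈ w≢s) m≤v

        ∈M : ∀ {w} → w ∈ S → w ≢ s → depth s v ≤ depth s w → w ∈ M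
        ∈M w∈ w≢s v≤w = ∈-filter⁺ deep? (∈-filter⁺ ≢s? w∈ w≢s) (≤-trans m≤v v≤w)

        ext′ : Extreme S v
        -- Maximality of `v` forces both ends into `M`, where `v` is extreme.
        ext′ x∈ z∈ b with between-level b v≢s (v-max x∈) (v-max z∈)
        ... | level x≢s z≢s v≤x v≤z = ext (∈M x∈ x≢s v≤x) (∈M z∈ z≢s v≤z) b

  -- Were also `w` in D(v), the root `s` would be between `v` and `w`. So D(v) ⊆ D(w), and `v`
  -- itself makes the inclusion strict.
  admissible-depth : Admissible G s → v ≢ s → w ≢ s → v ≢ w →
                     WalkAvoiding w s v → depth s v < depth s w
  admissible-depth {s} {v} {w} adm v≢s w≢s v≢w W =
    depth-mono-< (⊆-of-∉ v≁w w∉Dv) W (∉-own-component v≢s)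
    where
    v≁w : ¬ v ~ w
    v≁w = walk-head (walk-sym W) ∘ ~-sym

    w∉Dv : ¬ WalkAvoiding v s w
    w∉Dv W′ = adm v w (between⇒BD (between v≢s (≢-sym w≢s) v≢w (walk-sym W) W′))

  -- Elimination orders, listed from the last vertex to the first

  data Elimination (s : V G) : List (V G) → Set where
    []  : Elimination s []
    add : ∀ {L} → v ∉ L → Extreme L v → (∀ {w} → w ∈ L → ¬ WalkAvoiding w s v) →
          (v ≡ s → L ≡ []) → Elimination s L → Elimination s (v ∷ L)

  module _ (atFree : ATFree G) {s : V G} (adm : Admissible G s) where

    eliminate : ∀ k S → length S ≤ k → s ∈ S →
                ∃ λ L → Elimination s L × (∀ {v} → v ∈ L → v ∈ S) × (∀ {v} → v ∈ S → v ∈ L)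
    eliminate zero [] z≤n ()
    eliminate (suc k) S |S|≤ s∈S with Any.any? (λ w → ¬? (w ≟ s)) S
    ... | no ∄≢s = s ∷ [] , add (λ ()) (λ ()) (λ ()) (λ _ → refl) [] ,
                   (λ { (here refl) → s∈S }) ,
                   λ {v} v∈ → here (decidable-stable (v ≟ s) (λ v≢s → ∄≢s (lose v∈ v≢s)))
    ... | yes ∃≢s with exists-extreme atFree (suc k) S |S|≤ s∈S ∃≢s
    ...   | v , v∈S , v≢s , ext , max
          with eliminate k (filter (λ w → ¬? (w ≟ v)) S)
                 (≤-pred (≤-trans (filter-notAll (λ w → ¬? (w ≟ v)) S (lose v∈S (λ v≢v → v≢v refl))) |S|≤))
                 (∈-filter⁺ (λ w → ¬? (w ≟ v)) s∈S (≢-sym v≢s))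
    ...     | L , el , L⊆ , ⊆L =
      v ∷ L , add (λ v∈L → ≢v v∈L refl) (λ x∈ z∈ → ext (∈S x∈) (∈S z∈)) avoid
                  (λ v≡s → contradiction v≡s v≢s) el ,
      sound , complete
      where
      ≢v? : Decidable (_≢ v)
      ≢v? w = ¬? (w ≟ v)

      ∈S : ∀ {w} → w ∈ L → w ∈ S
      ∈S w∈ = proj₁ (∈-filter⁻ ≢v? {xs = S} (L⊆ w∈))

      ≢v : ∀ {w} → w ∈ L → w ≢ v
      ≢v w∈ = proj₂ (∈-filter⁻ ≢v? {xs = S} (L⊆ w∈))

      -- For `w` other than `s`, such a walk would make `w` strictly deeper than `v`, which was
      -- chosen deepest.
      avoid : ∀ {w} → w ∈ L → ¬ WalkAvoiding w s v
      avoid {w} w∈ W with w ≟ s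
      ... | yes refl = v≢s (sym (walkAvoiding-start W))
      ... | no w≢s   = <⇒≱ (admissible-depth adm v≢s w≢s (≢-sym (≢v w∈)) W) (max (∈S w∈) w≢s)

      sound : ∀ {w} → w ∈ v ∷ L → w ∈ S
      sound (here refl) = v∈S
      sound (there w∈)  = ∈S w∈

      complete : ∀ {w} → w ∈ S → w ∈ v ∷ L
      complete {w} w∈ with w ≟ v
      ... | yes eq = here eq
      ... | no w≢v = there (⊆L (∈-filter⁺ ≢v? w∈ w≢v))

  private
    variable
      L : List (V G)

  elimination-unique : Elimination s L → Unique L
  elimination-unique []                  = []
  elimination-unique (add v∉L _ _ _ el)  = ¬Any⇒All¬ _ v∉L ∷ elimination-unique el

  -- Were `y` listed before both `x` and `z`, it would be between two vertices of the tail it was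
  -- added to, against its extremality.
  elimination-between : Elimination s L → (x∈ : x ∈ L) (y∈ : y ∈ L) (z∈ : z ∈ L) → Between x y z →
                        toℕ (Any.index x∈) < toℕ (Any.index y∈) ⊎ toℕ (Any.index z∈) < toℕ (Any.index y∈)
  elimination-between _ (here refl) (here refl) _           b = contradiction refl (Between.x≢y b)
  elimination-between _ _           (here refl) (here refl) b = contradiction refl (Between.y≢z b)
  elimination-between (add _ ext _ _ _) (there x∈) (here refl) (there z∈) b = contradiction b (ext x∈ z∈)
  elimination-between _ (here _)    (there _)   _           b = inj₁ (s≤s z≤n)
  elimination-between _ (there _)   (there _)   (here _)    b = inj₂ (s≤s z≤n)
  elimination-between (add _ _ _ _ el) (there x∈) (there y∈) (there z∈) b
    with elimination-between el x∈ y∈ z∈ b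
  ... | inj₁ l = inj₁ (s≤s l)
  ... | inj₂ l = inj₂ (s≤s l)

  -- `w` was in the tail when `v` was added. An `s`-`v` path failing to dominate `w` would be such a
  -- walk.
  elimination-dominates : Elimination s L → (v∈ : v ∈ L) (w∈ : w ∈ L) → v ≢ w →
                          toℕ (Any.index v∈) ≤ toℕ (Any.index w∈) → ¬ WalkAvoiding w s v
  elimination-dominates _ (here refl) (here refl) v≢w _ _ = v≢w refl
  elimination-dominates (add _ _ av _ _) (here refl) (there w∈) _ _ = av w∈
  elimination-dominates (add _ _ _ _ el) (there v∈) (there w∈) v≢w (s≤s l) =
    elimination-dominates el v∈ w∈ v≢w l

  -- The root can be added only to the empty list, so it closes the list and opens the reversed
  -- order.
  elimination-root : Elimination s L → (s∈ : s ∈ L) → suc (toℕ (Any.index s∈)) ≡ length L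
  elimination-root (add _ _ _ last _) (here refl) with refl ← last refl = refl
  elimination-root (add _ _ _ _ el)   (there s∈)  = cong suc (elimination-root el s∈)

-- The reversed elimination list as a permutation of the vertices.

theorem4 : ∀ (n : ℕ) (G : Graph n) → Connected G → ATFree G →
    ∀ (s : V G) → Admissible G s →
    ∃ λ (τ : Permutation′ n) →
    BeginsIn G τ s × ATFreeOrder G τ × MonotoneDomPairOrder G τ
theorem4 n G _ atFree s adm
  with eliminate G atFree adm (length (allFin n)) (allFin n) ≤-refl (∈-allFin s)
... | L , el , _ , complete = τ , begins , atFreeOrder , domPair
  where
  ∈L : ∀ v → v ∈ L
  ∈L v = complete (∈-allFin v)

  index : V G → Fin (length L)
  index v = Any.index (∈L v)

  lookup-inverse : ∀ v → lookup L (index v) ≡ v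
  lookup-inverse v = sym (lookup-index (∈L v))

  listing : Permutation (length L) n
  listing = permutation (lookup L) index lookup-inverse
              (λ i → lookup-injective (elimination-unique G el) (lookup-inverse (lookup L i)))

  τ : Permutation′ n
  τ = proj₁ (toEndo (reverse ∘ₚ listing))

  pos-τ : ∀ v → toℕ (pos G τ v) ≡ toℕ (opposite (index v))
  pos-τ = proj₂ (toEndo (reverse ∘ₚ listing))

  index-anti : ∀ u v → toℕ (index u) < toℕ (index v) → _≺[_]_ G v τ u
  index-anti u v l = subst₂ _<_ (sym (pos-τ v)) (sym (pos-τ u)) (opposite-anti-< l)

  begins : BeginsIn G τ s
  begins = trans (pos-τ s) (trans (opposite-prop (index s))
             (trans (cong (length L ∸_) (elimination-root G el (∈L s))) (n∸n≡0 (length L))))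

  atFreeOrder : ATFreeOrder G τ
  atFreeOrder x y z bd with elimination-between G el (∈L x) (∈L y) (∈L z) (BD⇒between G bd)
  ... | inj₁ l = inj₁ (index-anti x y l)
  ... | inj₂ l = inj₂ (index-anti z y l)

  first-unique : ∀ {v} → BeginsIn G τ v → v ≡ s
  first-unique {v} b =
    trans (sym (inverseʳ τ)) (trans (cong (τ ⟨$⟩ʳ_) (toℕ-injective (trans b (sym begins)))) (inverseʳ τ))

  domPair : MonotoneDomPairOrder G τ
  domPair s′ b v p ip _ w w≤v with first-unique b
  -- If `w` is not dominated, `p` is a walk avoiding `w`, and `v`, being on `p`, differs from `w`.
  -- Positions reverse indices, so `w` is listed no earlier than `v`.
  ... | refl = decidable-stable (Any.any? (λ u → (u ≟ w) ⊎-dec _~?_ G u w) p) λ miss →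
    elimination-dominates G el (∈L v) (∈L w)
      (λ v≡w → miss (Any.map (λ v≡u → inj₁ (trans (sym v≡u) v≡w)) (last-∈ p (proj₁ (proj₂ ip)))))
      (≮⇒≥ (λ l → <⇒≱ (index-anti w v l) w≤v))
      (isPath⇒walk G p ip (All.map (λ ¬d e → ¬d (inj₂ (~-sym G e))) (¬Any⇒All¬ p miss)))
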